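{- Let $\mathbf{L}\in\{\mathbf{K}_D,\mathbf{KD}_D,\mathbf{KT}_D\}$. For every formula $A$: $\mathsf{H}(\mathbf{L})\vdash A$ if and only if $\mathsf{G}(\mathbf{L})\vdash\;\Rightarrow A$.
   Context: Language: fix a finite nonempty set $\mathsf{Agt}$ of agents and a countable set $\mathsf{Prop}$ of propositional variables; $\mathsf{Grp}$ is the set of nonempty subsets of $\mathsf{Agt}$. Formulas: $\alpha::=p\mid\bot\mid\alpha\wedge\alpha\mid\alpha\vee\alpha\mid\alpha\rightarrow\alpha\mid\neg\alpha\mid D_G\alpha$ ($p\in\mathsf{Prop}$, $G\in\mathsf{Grp}$). Outmost-boxed formula: one of the form $D_G\gamma$. Hilbert systems: $\mathsf{H}(\mathbf{K}_D)$ has all instances of propositional tautologies, $D_G(\alpha\rightarrow\beta)\rightarrow(D_G\alpha\rightarrow D_G\beta)$, $D_G\alpha\rightarrow D_H\alpha$ for $G\subseteq H$, modus ponens, and necessitation (from $\alpha$ infer $D_G\alpha$). $\mathsf{H}(\mathbf{KD}_D)$ adds $\neg D_{\{a\}}\bot$ for each $a\in\mathsf{Agt}$; $\mathsf{H}(\mathbf{KT}_D)$ adds $D_G\alpha\rightarrow\alpha$. Sequent calculi (sequents $\Gamma\Rightarrow\Delta$ are pairs of finite multisets; derivable = root of a finite tree built from initial sequents by rules): $\mathsf{G}(\mathbf{K}_D)$ has initial sequents $\Gamma,p\Rightarrow p,\Delta$ and $\bot,\Gamma\Rightarrow\Delta$; rules $(R\wedge)$ from $\Gamma\Rightarrow\Delta,\alpha_1$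 and $\Gamma\Rightarrow\Delta,\alpha_2$ infer $\Gamma\Rightarrow\Delta,\alpha_1\wedge\alpha_2$; $(L\wedge)$ from $\alpha_1,\alpha_2,\Gamma\Rightarrow\Delta$ infer $\alpha_1\wedge\alpha_2,\Gamma\Rightarrow\Delta$; $(R\vee)$ from $\Gamma\Rightarrow\Delta,\alpha_1,\alpha_2$ infer $\Gamma\Rightarrow\Delta,\alpha_1\vee\alpha_2$; $(L\vee)$ from $\alpha_1,\Gamma\Rightarrow\Delta$ and $\alpha_2,\Gamma\Rightarrow\Delta$ infer $\alpha_1\vee\alpha_2,\Gamma\Rightarrow\Delta$; $(R\rightarrow)$ from $\alpha_1,\Gamma\Rightarrow\Delta,\alpha_2$ infer $\Gamma\Rightarrow\Delta,\alpha_1\rightarrow\alpha_2$; $(L\rightarrow)$ from $\Gamma\Rightarrow\Delta,\alpha_1$ and $\alpha_2,\Gamma\Rightarrow\Delta$ infer $\alpha_1\rightarrow\alpha_2,\Gamma\Rightarrow\Delta$; $(R\neg)$ from $\alpha,\Gamma\Rightarrow\Delta$ infer $\Gamma\Rightarrow\Delta,\neg\alpha$; $(L\neg)$ from $\Gamma\Rightarrow\Delta,\alpha$ infer $\neg\alpha,\Gamma\Rightarrow\Delta$; $(D_K)$: from $\alpha_1,\dots,\alpha_n\Rightarrow\beta$ ($n\ge0$) infer $\Sigma,D_{G_1}\alpha_1,\dots,D_{G_n}\alpha_n\Rightarrow D_G\beta,\Omega$ where all $G_i\subseteq G$, $\Sigma$ consists only of propositional variables, $\bot$, and $D_H\gamma$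 with $H\not\subseteq G$, and $\Omega$ only of propositional variables, $\bot$, outmost-boxed formulas. $\mathsf{G}(\mathbf{KD}_D)$ adds $(D_D)$: from $\Gamma\Rightarrow$ with $\Gamma\neq\emptyset$ infer $\Sigma,D_{\{a\}}\Gamma\Rightarrow\Omega$ ($D_{\{a\}}\Gamma=\{D_{\{a\}}\gamma:\gamma\in\Gamma\}$), $\Sigma$ only propositional variables, $\bot$, $D_H\gamma$ with $H\neq\{a\}$; $\Omega$ only propositional variables, $\bot$, outmost-boxed formulas. $\mathsf{G}(\mathbf{KT}_D)$ adds to $\mathsf{G}(\mathbf{K}_D)$ $(D_T)$: from $D_G\alpha,\alpha,\Gamma\Rightarrow\Delta$ infer $D_G\alpha,\Gamma\Rightarrow\Delta$. -}

module Defs where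

open import Data.Bool.Base as Bool using (Bool; true; false; not)
open import Data.Fin.Base using (Fin)
open import Data.Fin.Subset as Subset using (Subset; Nonempty; ⁅_⁆)
open import Data.Fin.Subset.Properties using (x∈⁅x⁆)
open import Data.List.Base using (List; []; _∷_; [_]; _++_; map)
open import Data.List.Relation.Binary.Permutation.Propositional using (_↭_)
open import Data.List.Relation.Unary.All using (All)
open import Data.Nat.Base using (ℕ)
open import Data.Product.Base using (_×_; _,_; proj₁; proj₂; uncurry)
open import Data.Unit.Base using (⊤)
open import Relation.Binary.PropositionalEquality using (_≡_; _≢_)
open import Relation.Nullary.Negation using (¬_)

infixr 7 _∧′_
infixr 6 _∨′_
infixr 5 _→′_
infixr 8 ¬′_
infix  4 _⊆_ _⊈_

-- The set of agents is Fin n.  Nonemptiness is irrelevant, so that groups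
-- are equal as soon as their underlying subsets are.
record Grp (n : ℕ) : Set where
  constructor grp
  field
    members   : Subset n
    .nonempty : Nonempty members

open Grp public

_⊆_ : ∀ {n} → Grp n → Grp n → Set
G ⊆ H = members G Subset.⊆ members H

_⊈_ : ∀ {n} → Grp n → Grp n → Set
G ⊈ H = ¬ (G ⊆ H)

singleton : ∀ {n} → Fin n → Grp n
singleton a = grp ⁅ a ⁆ (a , x∈⁅x⁆ a)

data Formula (n : ℕ) (Var : Set) : Set where
  var  : Var → Formula n Var
  ⊥′   : Formula n Var
  _∧′_ : Formula n Var → Formula n Var → Formula n Var
  _∨′_ : Formula n Var → Formula n Var → Formula n Var
  _→′_ : Formula n Var → Formula n Var → Formula n Var
  ¬′_  : Formula n Var → Formula n Var
  D    : Grp n → Formula n Var → Formula n Var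

-- Modality-free formulas over schematic letters.  The letters are taken from ℕ
-- rather than Var, so that all tautology schemes exist even if Var is finite.
data Scheme : Set where
  letter : ℕ → Scheme
  ⊥ˢ     : Scheme
  _∧ˢ_   : Scheme → Scheme → Scheme
  _∨ˢ_   : Scheme → Scheme → Scheme
  _→ˢ_   : Scheme → Scheme → Scheme
  ¬ˢ_    : Scheme → Scheme

eval : (ℕ → Bool) → Scheme → Bool
eval v (letter x) = v x
eval v ⊥ˢ         = false
eval v (s ∧ˢ t)   = eval v s Bool.∧ eval v t
eval v (s ∨ˢ t)   = eval v s Bool.∨ eval v t
eval v (s →ˢ t)   = not (eval v s) Bool.∨ eval v t
eval v (¬ˢ s)     = not (eval v s)

Tautology : Scheme → Set
Tautology s = ∀ v → eval v s ≡ true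

data Logic : Set where
  K-D KD-D KT-D : Logic

module _ {n : ℕ} {Var : Set} where

  infix 3 _⊢ᴴ_ _⊢ᴳ_⇒_

  instantiate : (ℕ → Formula n Var) → Scheme → Formula n Var
  instantiate σ (letter x) = σ x
  instantiate σ ⊥ˢ         = ⊥′
  instantiate σ (s ∧ˢ t)   = instantiate σ s ∧′ instantiate σ t
  instantiate σ (s ∨ˢ t)   = instantiate σ s ∨′ instantiate σ t
  instantiate σ (s →ˢ t)   = instantiate σ s →′ instantiate σ t
  instantiate σ (¬ˢ s)     = ¬′ instantiate σ s

  data _⊢ᴴ_ : Logic → Formula n Var → Set where
    taut  : ∀ {L} s → Tautology s → (σ : ℕ → Formula n Var) → L ⊢ᴴ instantiate σ s
    ax-K  : ∀ {L} G α β → L ⊢ᴴ D G (α →′ β) →′ (D G α →′ D G β)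
    ax-⊆  : ∀ {L} G H α → G ⊆ H → L ⊢ᴴ D G α →′ D H α
    ax-D  : ∀ a → KD-D ⊢ᴴ ¬′ D (singleton a) ⊥′
    ax-T  : ∀ G α → KT-D ⊢ᴴ D G α →′ α
    mp    : ∀ {L α β} → L ⊢ᴴ α →′ β → L ⊢ᴴ α → L ⊢ᴴ β
    nec   : ∀ {L α} G → L ⊢ᴴ α → L ⊢ᴴ D G α

  data Side (P : Grp n → Set) : Formula n Var → Set where
    var : ∀ p → Side P (var p)
    bot : Side P ⊥′
    box : ∀ {H} γ → P H → Side P (D H γ)

  -- Multisets are lists up to permutation: the constructor exch identifies
  -- sequents with the same underlying multisets and is not a rule of the calculus.
  data _⊢ᴳ_⇒_ : Logic → List (Formula n Var) → List (Formula n Var) → Set where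
    exch : ∀ {L Γ Γ′ Δ Δ′} → Γ ↭ Γ′ → Δ ↭ Δ′ → L ⊢ᴳ Γ ⇒ Δ → L ⊢ᴳ Γ′ ⇒ Δ′
    init : ∀ {L Γ Δ} p → L ⊢ᴳ var p ∷ Γ ⇒ var p ∷ Δ
    init⊥ : ∀ {L Γ Δ} → L ⊢ᴳ ⊥′ ∷ Γ ⇒ Δ
    R∧   : ∀ {L Γ Δ α β} → L ⊢ᴳ Γ ⇒ α ∷ Δ → L ⊢ᴳ Γ ⇒ β ∷ Δ → L ⊢ᴳ Γ ⇒ (α ∧′ β) ∷ Δ
    L∧   : ∀ {L Γ Δ α β} → L ⊢ᴳ α ∷ β ∷ Γ ⇒ Δ → L ⊢ᴳ (α ∧′ β) ∷ Γ ⇒ Δ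
    R∨   : ∀ {L Γ Δ α β} → L ⊢ᴳ Γ ⇒ α ∷ β ∷ Δ → L ⊢ᴳ Γ ⇒ (α ∨′ β) ∷ Δ
    L∨   : ∀ {L Γ Δ α β} → L ⊢ᴳ α ∷ Γ ⇒ Δ → L ⊢ᴳ β ∷ Γ ⇒ Δ → L ⊢ᴳ (α ∨′ β) ∷ Γ ⇒ Δ
    R→   : ∀ {L Γ Δ α β} → L ⊢ᴳ α ∷ Γ ⇒ β ∷ Δ → L ⊢ᴳ Γ ⇒ (α →′ β) ∷ Δ
    L→   : ∀ {L Γ Δ α β} → L ⊢ᴳ Γ ⇒ α ∷ Δ → L ⊢ᴳ β ∷ Γ ⇒ Δ → L ⊢ᴳ (α →′ β) ∷ Γ ⇒ Δ
    R¬   : ∀ {L Γ Δ α} → L ⊢ᴳ α ∷ Γ ⇒ Δ → L ⊢ᴳ Γ ⇒ (¬′ α) ∷ Δ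
    L¬   : ∀ {L Γ Δ α} → L ⊢ᴳ Γ ⇒ α ∷ Δ → L ⊢ᴳ (¬′ α) ∷ Γ ⇒ Δ
    -- The list Gαs holds the pairs (G₁ , α₁), …, (Gₙ , αₙ).
    D-K  : ∀ {L Σ Ω G β} (Gαs : List (Grp n × Formula n Var)) →
           All (λ Gα → proj₁ Gα ⊆ G) Gαs →
           All (Side (_⊈ G)) Σ → All (Side (λ _ → ⊤)) Ω →
           L ⊢ᴳ map proj₂ Gαs ⇒ [ β ] →
           L ⊢ᴳ Σ ++ map (uncurry D) Gαs ⇒ D G β ∷ Ω
    D-D  : ∀ {Γ Σ Ω} a → Γ ≢ [] →
           All (Side (_≢ singleton a)) Σ → All (Side (λ _ → ⊤)) Ω →
           KD-D ⊢ᴳ Γ ⇒ [] →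
           KD-D ⊢ᴳ Σ ++ map (D (singleton a)) Γ ⇒ Ω
    D-T  : ∀ {Γ Δ G α} → KT-D ⊢ᴳ D G α ∷ α ∷ Γ ⇒ Δ → KT-D ⊢ᴳ D G α ∷ Γ ⇒ Δ

{-# OPTIONS --safe #-}
module Submission where

-- From the sequent calculus to the Hilbert system: a derivable sequent Γ ⇒ Δ
-- is inconsistent in the sense that any hypotheses proving Γ and refuting Δ
-- prove ⊥′.
-- Conversely, no cut elimination is needed.  The Hilbert system is sound for
-- finite trees whose edges carry groups, an edge labelled H counting for every
-- G ⊆ H.  Backward proof search turns every sequent into a derivation or a
-- tree refuting it; it terminates because the propositional rules and D-T are
-- applied once to every formula occurrence, while D-K and D-D lower the modal
-- depth.

open import Data.Bool.Base as Bool using (Bool; true; false; not; if_then_else_)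
open import Data.Bool.ListAction using (all)
open import Data.Bool.Properties using (∧-zeroʳ; ∨-zeroʳ)
open import Data.Empty using (⊥; ⊥-elim; ⊥-elim-irr)
open import Data.Fin.Properties using (any?)
open import Data.Fin.Subset as Subset using ()
open import Data.Fin.Subset.Properties as Subsetₚ using (x∈⁅y⁆⇒x≡y; ⊆-antisym)
open import Data.List.Base using (List; []; _∷_; [_]; _++_; map; filter; allFin)
open import Data.List.Properties using (++-assoc; ++-identityʳ; map-++)
open import Data.List.Membership.Propositional using (_∈_; find; lose)
open import Data.List.Membership.Propositional.Properties using (∈-filter⁺; ∈-filter⁻; ∈-map⁺; ∈-map⁻; ∈-++⁺ˡ; ∈-++⁺ʳ; ∈-++⁻; ∈-allFin; ∈-∃++)
open import Data.List.Relation.Binary.Permutation.Propositional using (_↭_; ↭-refl; ↭-sym; ↭-trans; prep; swap)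
open import Data.List.Relation.Binary.Permutation.Propositional.Properties using (All-resp-↭; shift; map⁺; ++⁺ˡ)
open import Data.List.Relation.Unary.All as All using (All; []; _∷_)
open import Data.List.Relation.Unary.All.Properties as Allₚ using ()
open import Data.List.Relation.Unary.Any as Any using (Any; here; there)
open import Data.Maybe.Base using (Maybe; just; nothing; maybe′)
open import Data.Nat.Base using (ℕ; zero; suc; _⊔_; _≤_; _<_; s≤s⁻¹)
open import Data.Nat.Properties as ℕ using (m⊔n≤o⇒m≤o; m⊔n≤o⇒n≤o; ≤-refl)
open import Data.Product.Base as Product using (_×_; _,_; proj₁; proj₂; uncurry; ∃)
open import Data.Sum.Base as Sum using (_⊎_; inj₁; inj₂)
open import Data.Unit.Base using (⊤; tt)
open import Function.Base using (_∘_)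
open import Function.Bundles using (_⇔_; _↣_; mk⇔)
open import Relation.Binary.Definitions using (DecidableEquality)
open import Relation.Binary.PropositionalEquality using (_≡_; _≢_; refl; sym; trans; cong; cong₂; subst; subst₂)
open import Relation.Nullary using (¬_; Dec; yes; no; does; ¬?)
open import Relation.Nullary.Decidable using (via-injection; _×-dec_; dec-true; dec-false)
open import Relation.Unary using (Decidable)
open import Defs

-- From sequents to the Hilbert system

∧-true : ∀ {a b} → a Bool.∧ b ≡ true → a ≡ true × b ≡ true
∧-true {true} {true} _ = refl , refl

module _ {n : ℕ} {Var : Set} where

  infix 3 _∣_⊢_

  private
    Fm : Set
    Fm = Formula n Var

  -- Necessitation enters only inside `thm`, never above a hypothesis; this is what makes the
  -- deduction theorem hold.
  data _∣_⊢_ (L : Logic) (Φ : List Fm) : Fm → Set where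
    hyp : ∀ {α} → α ∈ Φ → L ∣ Φ ⊢ α
    thm : ∀ {α} → L ⊢ᴴ α → L ∣ Φ ⊢ α
    _·_ : ∀ {α β} → L ∣ Φ ⊢ α →′ β → L ∣ Φ ⊢ α → L ∣ Φ ⊢ β

  infixl 9 _·_

  letters₃ : ∀ {A : Set} → A → A → A → ℕ → A
  letters₃ a b c 0 = a
  letters₃ a b c 1 = b
  letters₃ a b c _ = c

  ∀ᵇ : (Bool → Bool) → Bool
  ∀ᵇ f = f false Bool.∧ f true

  ∀ᵇ-sound : ∀ f → ∀ᵇ f ≡ true → ∀ a → f a ≡ true
  ∀ᵇ-sound f p false = proj₁ (∧-true p)
  ∀ᵇ-sound f p true  = proj₂ (∧-true p)

  forall₃ : (Bool → Bool → Bool → Bool) → Bool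
  forall₃ f = ∀ᵇ λ a → ∀ᵇ λ b → ∀ᵇ λ c → f a b c

  forall₃-sound : ∀ f → forall₃ f ≡ true → ∀ a b c → f a b c ≡ true
  forall₃-sound f p a b c =
    ∀ᵇ-sound (f a b)
      (∀ᵇ-sound (λ b → ∀ᵇ (f a b)) (∀ᵇ-sound (λ a → ∀ᵇ λ b → ∀ᵇ (f a b)) p a) b) c

  -- Both hypotheses hold by refl for a concrete tautology in the letters 0, 1, 2.
  taut₃ : ∀ {L Φ} s →
          (∀ v → eval v s ≡ eval (letters₃ (v 0) (v 1) (v 2)) s) →
          forall₃ (λ a b c → eval (letters₃ a b c) s) ≡ true →
          ∀ α β γ → L ∣ Φ ⊢ instantiate (letters₃ α β γ) s
  taut₃ s local valid α β γ =
    thm (taut s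
      (λ v → trans (local v)
        (forall₃-sound (λ a b c → eval (letters₃ a b c) s) valid (v 0) (v 1) (v 2)))
      (letters₃ α β γ))

  private
    x y z : Scheme
    x = letter 0
    y = letter 1
    z = letter 2

  module _ {L : Logic} where

    deduction : ∀ {Φ α β} → L ∣ α ∷ Φ ⊢ β → L ∣ Φ ⊢ α →′ β
    deduction {α = α} (hyp (here refl)) =
      taut₃ (x →ˢ x) (λ _ → refl) refl α α α
    deduction {α = α} {β} (hyp (there i)) =
      taut₃ (x →ˢ (y →ˢ x)) (λ _ → refl) refl β α α · hyp i
    deduction {α = α} {β} (thm h) =
      taut₃ (x →ˢ (y →ˢ x)) (λ _ → refl) refl β α α · thm h
    deduction {α = α} {β} (_·_ {γ} d e) =
      taut₃ ((x →ˢ (y →ˢ z)) →ˢ ((x →ˢ y) →ˢ (x →ˢ z))) (λ _ → refl) refl α γ β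
        · deduction d · deduction e

    weaken : ∀ {Φ α β} → L ∣ Φ ⊢ α → L ∣ β ∷ Φ ⊢ α
    weaken (hyp i) = hyp (there i)
    weaken (thm h) = thm h
    weaken (d · e) = weaken d · weaken e

    closed : ∀ {α} → L ∣ [] ⊢ α → L ⊢ᴴ α
    closed (thm h) = h
    closed (d · e) = mp (closed d) (closed e)

    by-contradiction : ∀ {Φ α} → L ∣ ¬′ α ∷ Φ ⊢ ⊥′ → L ∣ Φ ⊢ α
    by-contradiction {α = α} d =
      taut₃ (((¬ˢ x) →ˢ ⊥ˢ) →ˢ x) (λ _ → refl) refl α α α · deduction d

    ¬-intro : ∀ {Φ α} → L ∣ α ∷ Φ ⊢ ⊥′ → L ∣ Φ ⊢ ¬′ α
    ¬-intro {α = α} d =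
      taut₃ ((x →ˢ ⊥ˢ) →ˢ (¬ˢ x)) (λ _ → refl) refl α α α · deduction d

    ¬-elim : ∀ {Φ α} → L ∣ Φ ⊢ ¬′ α → L ∣ Φ ⊢ α → L ∣ Φ ⊢ ⊥′
    ¬-elim {α = α} d e =
      taut₃ ((¬ˢ x) →ˢ (x →ˢ ⊥ˢ)) (λ _ → refl) refl α α α · d · e

    -- The deduction theorem moves the hypotheses into the conclusion until none is left and
    -- necessitation applies; `ax-K` then discharges them one by one under the box.
    D-mono : ∀ {Φ G α} αs → L ∣ αs ⊢ α →
             All (λ γ → L ∣ Φ ⊢ D G γ) αs → L ∣ Φ ⊢ D G α
    D-mono {G = G} [] d [] = thm (nec G (closed d))
    D-mono {G = G} {α} (γ ∷ γs) d (e ∷ es) =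
      thm (ax-K G γ α) · D-mono γs (deduction d) es · e

    -- Quantifying over `Φ` replaces the translation of a sequent into one implication: permutations
    -- act on the `All` proofs, and a premise can be used under the extra hypothesis of `prove` or
    -- `refute`.
    Inconsistent : List Fm → List Fm → Set
    Inconsistent Γ Δ =
      ∀ {Φ} → All (L ∣ Φ ⊢_) Γ → All (λ δ → L ∣ Φ ⊢ ¬′ δ) Δ → L ∣ Φ ⊢ ⊥′

    prove : ∀ {Γ Δ α Φ} → Inconsistent Γ (α ∷ Δ) →
            All (L ∣ Φ ⊢_) Γ → All (λ δ → L ∣ Φ ⊢ ¬′ δ) Δ → L ∣ Φ ⊢ α
    prove inc γs δs =
      by-contradiction (inc (All.map weaken γs) (hyp (here refl) ∷ All.map weaken δs))

    refute : ∀ {Γ Δ α Φ} → Inconsistent (α ∷ Γ) Δ →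
             All (L ∣ Φ ⊢_) Γ → All (λ δ → L ∣ Φ ⊢ ¬′ δ) Δ → L ∣ Φ ⊢ ¬′ α
    refute inc γs δs =
      ¬-intro (inc (hyp (here refl) ∷ All.map weaken γs) (All.map weaken δs))

  derivable⇒inconsistent : ∀ {L Γ Δ} → L ⊢ᴳ Γ ⇒ Δ → Inconsistent {L} Γ Δ
  derivable⇒inconsistent (exch p q d) γs δs =
    derivable⇒inconsistent d (All-resp-↭ (↭-sym p) γs) (All-resp-↭ (↭-sym q) δs)
  derivable⇒inconsistent (init p) (γ ∷ _) (δ ∷ _) = ¬-elim δ γ
  derivable⇒inconsistent init⊥ (γ ∷ _) _ = γ
  derivable⇒inconsistent (R∧ {α = α} {β} d e) γs (δ ∷ δs) =
    ¬-elim δ (taut₃ (x →ˢ (y →ˢ (x ∧ˢ y))) (λ _ → refl) refl α β β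
      · prove (derivable⇒inconsistent d) γs δs
      · prove (derivable⇒inconsistent e) γs δs)
  derivable⇒inconsistent (L∧ {α = α} {β} d) (γ ∷ γs) δs =
    derivable⇒inconsistent d
      (taut₃ ((x ∧ˢ y) →ˢ x) (λ _ → refl) refl α β β · γ
        ∷ taut₃ ((x ∧ˢ y) →ˢ y) (λ _ → refl) refl α β β · γ ∷ γs) δs
  derivable⇒inconsistent (R∨ {α = α} {β} d) γs (δ ∷ δs) =
    derivable⇒inconsistent d γs
      (taut₃ ((¬ˢ (x ∨ˢ y)) →ˢ (¬ˢ x)) (λ _ → refl) refl α β β · δ
        ∷ taut₃ ((¬ˢ (x ∨ˢ y)) →ˢ (¬ˢ y)) (λ _ → refl) refl α β β · δ ∷ δs)
  derivable⇒inconsistent (L∨ {α = α} {β} d e) (γ ∷ γs) δs =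
    taut₃ ((x ∨ˢ y) →ˢ ((¬ˢ x) →ˢ ((¬ˢ y) →ˢ ⊥ˢ))) (λ _ → refl) refl α β β · γ
      · refute (derivable⇒inconsistent d) γs δs
      · refute (derivable⇒inconsistent e) γs δs
  derivable⇒inconsistent (R→ {α = α} {β} d) γs (δ ∷ δs) =
    derivable⇒inconsistent d
      (taut₃ ((¬ˢ (x →ˢ y)) →ˢ x) (λ _ → refl) refl α β β · δ ∷ γs)
      (taut₃ ((¬ˢ (x →ˢ y)) →ˢ (¬ˢ y)) (λ _ → refl) refl α β β · δ ∷ δs)
  derivable⇒inconsistent (L→ d e) (γ ∷ γs) δs =
    ¬-elim (refute (derivable⇒inconsistent e) γs δs)
      (γ · prove (derivable⇒inconsistent d) γs δs)
  derivable⇒inconsistent (R¬ d) γs (δ ∷ δs) =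
    ¬-elim δ (refute (derivable⇒inconsistent d) γs δs)
  derivable⇒inconsistent (L¬ d) (γ ∷ γs) δs =
    ¬-elim γ (prove (derivable⇒inconsistent d) γs δs)
  derivable⇒inconsistent {L} (D-K {Σ = Σ} {G = G} Gαs ⊆G _ _ d) {Φ} γs (δ ∷ _) =
    -- The premise is read with its own antecedent as hypotheses, where it proves β. `ax-⊆` raises
    -- every box to the group `G`, so that `D-mono` applies.
    ¬-elim δ (D-mono (map proj₂ Gαs)
      (prove (derivable⇒inconsistent d) (All.tabulate hyp) [])
      (boxes Gαs ⊆G (Allₚ.++⁻ʳ Σ γs)))
    where
    boxes : ∀ Gαs → All (λ Gα → proj₁ Gα ⊆ G) Gαs →
            All (L ∣ Φ ⊢_) (map (uncurry D) Gαs) →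
            All (λ γ → L ∣ Φ ⊢ D G γ) (map proj₂ Gαs)
    boxes [] [] [] = []
    boxes ((H , α) ∷ Gαs) (i ∷ is) (e ∷ es) =
      thm (ax-⊆ H G α i) · e ∷ boxes Gαs is es
  derivable⇒inconsistent (D-D {Γ = Γ} {Σ = Σ} a _ _ _ d) γs _ =
    -- An empty succedent means that `Γ` proves ⊥′, so the boxes prove `D (singleton a) ⊥′`.
    ¬-elim (thm (ax-D a))
      (D-mono Γ (derivable⇒inconsistent d (All.tabulate hyp) [])
        (Allₚ.map⁻ (Allₚ.++⁻ʳ Σ γs)))
  derivable⇒inconsistent (D-T {G = G} {α} d) (γ ∷ γs) δs =
    derivable⇒inconsistent d (γ ∷ thm (ax-T G α) · γ ∷ γs) δs

  sequent⇒hilbert : ∀ {L A} → L ⊢ᴳ [] ⇒ [ A ] → L ⊢ᴴ A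
  sequent⇒hilbert d = closed (prove (derivable⇒inconsistent d) [] [])

-- Tree semantics

⊆-singleton : ∀ {n} {G : Grp n} {a} → G ⊆ singleton a → singleton a ⊆ G
⊆-singleton {G = grp s ne} {a} G⊆a i with x∈⁅y⁆⇒x≡y a i
-- The member of `s` comes from an irrelevant proof and may only be used to reach a contradiction,
-- so membership is decided first.
... | refl with a Subsetₚ.∈? s
...   | yes a∈s = a∈s
...   | no  a∉s = ⊥-elim-irr (a∉s (member ne))
  where
  member : Subset.Nonempty s → a Subset.∈ s
  member (b , b∈s) = subst (Subset._∈ s) (x∈⁅y⁆⇒x≡y a (G⊆a b∈s)) b∈s

⊆-singleton⇒≡ : ∀ {n} {G : Grp n} {a} → G ⊆ singleton a → G ≡ singleton a
⊆-singleton⇒≡ {G = G@(grp s _)} {a} G⊆a with ⊆-antisym G⊆a (⊆-singleton {G = G} G⊆a)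
... | refl = refl

_⊆?_ : ∀ {n} (G H : Grp n) → Dec (G ⊆ H)
G ⊆? H = members G Subsetₚ.⊆? members H

module _ {A : Set} {f : A → Bool} where

  all-true⁺ : ∀ xs → (∀ {x} → x ∈ xs → f x ≡ true) → all f xs ≡ true
  all-true⁺ []       h = refl
  all-true⁺ (x ∷ xs) h rewrite h (here refl) = all-true⁺ xs (h ∘ there)

  all-true⁻ : ∀ {xs x} → all f xs ≡ true → x ∈ xs → f x ≡ true
  all-true⁻ h (here refl) = proj₁ (∧-true h)
  all-true⁻ {y ∷ _} h (there i) = all-true⁻ (proj₂ (∧-true {f y} h)) i

module _ {n : ℕ} {Var : Set} where

  private
    Fm : Set
    Fm = Formula n Var

  data Tree : Set where
    node : (Var → Bool) → List (Grp n × Tree) → Tree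

  valuation : Tree → Var → Bool
  valuation (node v _) = v

  children : Tree → List (Grp n × Tree)
  children (node _ ts) = ts

  -- A finite tree is not serial, so in KD-D a node without {a}-successor gets a
  -- loop; in the trees built by proof search no D {a} γ has to hold at such a node.
  SelfLoop : Logic → Grp n → Tree → Set
  SelfLoop K-D  G t = ⊥
  SelfLoop KD-D G t = (∃ λ a → G ⊆ singleton a) × All (λ c → G ⊈ proj₁ c) (children t)
  SelfLoop KT-D G t = ⊤

  selfLoop? : ∀ L G t → Dec (SelfLoop L G t)
  selfLoop? K-D  G t = no λ ()
  selfLoop? KD-D G t = any? (λ a → G ⊆? singleton a) ×-dec
                       All.all? (λ c → ¬? (G ⊆? proj₁ c)) (children t)
  selfLoop? KT-D G t = yes tt

  Step : Logic → Grp n → Tree → Tree → Set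
  Step L G t u = (SelfLoop L G t × u ≡ t) ⊎ (∃ λ K → G ⊆ K × (K , u) ∈ children t)

  loops : Logic → Grp n → Tree → List Tree
  loops L G t = if does (selfLoop? L G t) then [ t ] else []

  -- `Step` as a finite list: this lets `sat` compute a Boolean, so that tautologies are evaluated
  -- directly and every formula is true or false at a tree.
  successors : Logic → Grp n → Tree → List Tree
  successors L G t =
    loops L G t ++ map proj₂ (filter (λ c → G ⊆? proj₁ c) (children t))

  successors⇒Step : ∀ L {G t u} → u ∈ successors L G t → Step L G t u
  successors⇒Step L {G} {t} i with ∈-++⁻ (loops L G t) i
  successors⇒Step L {G} {t} i | inj₁ j with selfLoop? L G t
  successors⇒Step L {G} {t} i | inj₁ (here refl) | yes loop = inj₁ (loop , refl)
  successors⇒Step L {G} {t} i | inj₂ j with ∈-map⁻ proj₂ j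
  ... | (K , u) , k , refl with ∈-filter⁻ (λ c → G ⊆? proj₁ c) {xs = children t} k
  ...   | m , G⊆K = inj₂ (K , G⊆K , m)

  Step⇒successors : ∀ L {G t u} → Step L G t u → u ∈ successors L G t
  Step⇒successors L {G} {t} (inj₁ (loop , refl)) with selfLoop? L G t
  ... | yes _  = here refl
  ... | no ¬l = ⊥-elim (¬l loop)
  Step⇒successors L {G} {t} (inj₂ (K , G⊆K , i)) =
    ∈-++⁺ʳ (loops L G t) (∈-map⁺ proj₂ (∈-filter⁺ (λ c → G ⊆? proj₁ c) i G⊆K))

  Step-antitone : ∀ L {G H t u} → G ⊆ H → Step L H t u → Step L G t u
  Step-antitone L G⊆H (inj₂ (K , H⊆K , i)) = inj₂ (K , H⊆K ∘ G⊆H , i)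
  Step-antitone KT-D G⊆H (inj₁ loop) = inj₁ loop
  -- Both groups are nonempty and lie within `singleton a`, so they coincide; a child label
  -- containing `G` would therefore contain `H`.
  Step-antitone KD-D {G} {H} G⊆H (inj₁ (((a , H⊆a) , none) , eq)) =
    inj₁ (((a , H⊆a ∘ G⊆H) , All.map (λ H⊈K G⊆K → H⊈K λ i → G⊆K (H⊆G i)) none) , eq)
    where
    H⊆G : H ⊆ G
    H⊆G = ⊆-singleton {G = G} (H⊆a ∘ G⊆H) ∘ H⊆a

  Step-serial : ∀ a t → ∃ (Step KD-D (singleton a) t)
  Step-serial a t with Any.any? (λ c → singleton a ⊆? proj₁ c) (children t)
  ... | no  none = t , inj₁ (((a , λ i → i) , Allₚ.¬Any⇒All¬ _ none) , refl)
  ... | yes some with find some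
  ...   | (K , u) , i , a⊆K = u , inj₂ (K , a⊆K , i)

  -- Satisfaction and soundness of the Hilbert system

  sat : Logic → Tree → Fm → Bool
  sat L t (var p)  = valuation t p
  sat L t ⊥′       = false
  sat L t (α ∧′ β) = sat L t α Bool.∧ sat L t β
  sat L t (α ∨′ β) = sat L t α Bool.∨ sat L t β
  sat L t (α →′ β) = not (sat L t α) Bool.∨ sat L t β
  sat L t (¬′ α)   = not (sat L t α)
  sat L t (D G α)  = all (λ u → sat L u α) (successors L G t)

  infix 3 _∣_⊨_ _∣_⊭_

  -- Records rather than abbreviations: sat computes, so L, t and α could not
  -- be inferred from an equation.
  record _∣_⊨_ (L : Logic) (t : Tree) (α : Fm) : Set where
    constructor ⊨-intro
    field sat-true : sat L t α ≡ true

  record _∣_⊭_ (L : Logic) (t : Tree) (α : Fm) : Set where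
    constructor ⊭-intro
    field sat-false : sat L t α ≡ false

  open _∣_⊨_
  open _∣_⊭_

  ⊨-⊭ : ∀ {L t α} → L ∣ t ⊨ α → L ∣ t ⊭ α → ⊥
  ⊨-⊭ (⊨-intro p) (⊭-intro q) with trans (sym p) q
  ... | ()

  module _ {L : Logic} {t : Tree} where

    ⊨? : ∀ α → L ∣ t ⊨ α ⊎ L ∣ t ⊭ α
    ⊨? α with sat L t α in eq
    ... | true  = inj₁ (⊨-intro eq)
    ... | false = inj₂ (⊭-intro eq)

    ⊨∧⁺ : ∀ {α β} → L ∣ t ⊨ α → L ∣ t ⊨ β → L ∣ t ⊨ α ∧′ β
    ⊨∧⁺ (⊨-intro p) (⊨-intro q) = ⊨-intro (cong₂ Bool._∧_ p q)

    ⊭∧⁺ˡ : ∀ {α β} → L ∣ t ⊭ α → L ∣ t ⊭ α ∧′ β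
    ⊭∧⁺ˡ {β = β} (⊭-intro p) = ⊭-intro (cong (Bool._∧ sat L t β) p)

    ⊭∧⁺ʳ : ∀ {α β} → L ∣ t ⊭ β → L ∣ t ⊭ α ∧′ β
    ⊭∧⁺ʳ {α} (⊭-intro p) =
      ⊭-intro (trans (cong (sat L t α Bool.∧_) p) (∧-zeroʳ (sat L t α)))

    ⊨∨⁺ˡ : ∀ {α β} → L ∣ t ⊨ α → L ∣ t ⊨ α ∨′ β
    ⊨∨⁺ˡ {β = β} (⊨-intro p) = ⊨-intro (cong (Bool._∨ sat L t β) p)

    ⊨∨⁺ʳ : ∀ {α β} → L ∣ t ⊨ β → L ∣ t ⊨ α ∨′ β
    ⊨∨⁺ʳ {α} (⊨-intro p) =
      ⊨-intro (trans (cong (sat L t α Bool.∨_) p) (∨-zeroʳ (sat L t α)))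

    ⊭∨⁺ : ∀ {α β} → L ∣ t ⊭ α → L ∣ t ⊭ β → L ∣ t ⊭ α ∨′ β
    ⊭∨⁺ (⊭-intro p) (⊭-intro q) = ⊭-intro (cong₂ Bool._∨_ p q)

    ⊨→⁺ˡ : ∀ {α β} → L ∣ t ⊭ α → L ∣ t ⊨ α →′ β
    ⊨→⁺ˡ {β = β} (⊭-intro p) = ⊨-intro (cong (λ a → not a Bool.∨ sat L t β) p)

    ⊨→⁺ʳ : ∀ {α β} → L ∣ t ⊨ β → L ∣ t ⊨ α →′ β
    ⊨→⁺ʳ {α} (⊨-intro p) =
      ⊨-intro (trans (cong (not (sat L t α) Bool.∨_) p) (∨-zeroʳ (not (sat L t α))))

    ⊭→⁺ : ∀ {α β} → L ∣ t ⊨ α → L ∣ t ⊭ β → L ∣ t ⊭ α →′ β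
    ⊭→⁺ (⊨-intro p) (⊭-intro q) = ⊭-intro (cong₂ (λ a b → not a Bool.∨ b) p q)

    ⊨¬⁺ : ∀ {α} → L ∣ t ⊭ α → L ∣ t ⊨ ¬′ α
    ⊨¬⁺ (⊭-intro p) = ⊨-intro (cong not p)

    ⊭¬⁺ : ∀ {α} → L ∣ t ⊨ α → L ∣ t ⊭ ¬′ α
    ⊭¬⁺ (⊨-intro p) = ⊭-intro (cong not p)

    ⊨→⁺ : ∀ {α β} → (L ∣ t ⊨ α → L ∣ t ⊨ β) → L ∣ t ⊨ α →′ β
    ⊨→⁺ {α} h with ⊨? α
    ... | inj₁ p = ⊨→⁺ʳ (h p)
    ... | inj₂ p = ⊨→⁺ˡ p

    ⊨→⁻ : ∀ {α β} → L ∣ t ⊨ α →′ β → L ∣ t ⊨ α → L ∣ t ⊨ β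
    ⊨→⁻ {β = β} p q with ⊨? β
    ... | inj₁ r = r
    ... | inj₂ r = ⊥-elim (⊨-⊭ p (⊭→⁺ q r))

    ⊨D⁺ : ∀ {G α} → (∀ {u} → Step L G t u → L ∣ u ⊨ α) → L ∣ t ⊨ D G α
    ⊨D⁺ {G} {α} h =
      ⊨-intro (all-true⁺ (successors L G t) (sat-true ∘ h ∘ successors⇒Step L))

    ⊨D⁻ : ∀ {G u α} → L ∣ t ⊨ D G α → Step L G t u → L ∣ u ⊨ α
    ⊨D⁻ {α = α} (⊨-intro p) s =
      ⊨-intro (all-true⁻ {f = λ u → sat L u α} p (Step⇒successors L s))

    ⊭D⁺ : ∀ {G u α} → Step L G t u → L ∣ u ⊭ α → L ∣ t ⊭ D G α
    ⊭D⁺ {G} {α = α} s q with ⊨? (D G α)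
    ... | inj₁ p = ⊥-elim (⊨-⊭ (⊨D⁻ p s) q)
    ... | inj₂ p = p

    sat-instantiate : ∀ σ s → sat L t (instantiate σ s) ≡ eval (sat L t ∘ σ) s
    sat-instantiate σ (letter x) = refl
    sat-instantiate σ ⊥ˢ = refl
    sat-instantiate σ (s ∧ˢ u) = cong₂ Bool._∧_ (sat-instantiate σ s) (sat-instantiate σ u)
    sat-instantiate σ (s ∨ˢ u) = cong₂ Bool._∨_ (sat-instantiate σ s) (sat-instantiate σ u)
    sat-instantiate σ (s →ˢ u) =
      cong₂ (λ a b → not a Bool.∨ b) (sat-instantiate σ s) (sat-instantiate σ u)
    sat-instantiate σ (¬ˢ s) = cong not (sat-instantiate σ s)

  hilbert-sound : ∀ {L α} → L ⊢ᴴ α → ∀ t → L ∣ t ⊨ α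
  hilbert-sound {L} (taut s valid σ) t =
    ⊨-intro (trans (sat-instantiate σ s) (valid (sat L t ∘ σ)))
  hilbert-sound (ax-K G α β) t =
    ⊨→⁺ λ p → ⊨→⁺ λ q → ⊨D⁺ λ s → ⊨→⁻ (⊨D⁻ p s) (⊨D⁻ q s)
  hilbert-sound {L} (ax-⊆ G H α G⊆H) t =
    ⊨→⁺ λ p → ⊨D⁺ λ s → ⊨D⁻ p (Step-antitone L {G} {H} G⊆H s)
  hilbert-sound (ax-D a) t = ⊨¬⁺ (⊭D⁺ (proj₂ (Step-serial a t)) (⊭-intro refl))
  hilbert-sound (ax-T G α) t = ⊨→⁺ λ p → ⊨D⁻ p (inj₁ (tt , refl))
  hilbert-sound (mp d e) t = ⊨→⁻ (hilbert-sound d t) (hilbert-sound e t)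
  hilbert-sound (nec G d) t = ⊨D⁺ λ {u} _ → hilbert-sound d u

-- Proof search

module _ {A : Set} {P : A → Set} (P? : Decidable P) where

  filter-↭ : ∀ xs → filter (¬? ∘ P?) xs ++ filter P? xs ↭ xs
  filter-↭ [] = ↭-refl
  filter-↭ (x ∷ xs) with P? x
  ... | yes _ = ↭-trans (shift x (filter (¬? ∘ P?) xs) _) (prep x (filter-↭ xs))
  ... | no  _ = prep x (filter-↭ xs)

∈⇒↭ : ∀ {A : Set} {x : A} {xs} → x ∈ xs → ∃ λ ys → x ∷ ys ↭ xs
∈⇒↭ {x = x} i with ∈-∃++ i
... | ys , zs , refl = ys ++ zs , ↭-sym (shift x ys zs)

KT? : ∀ L → Dec (L ≡ KT-D)
KT? K-D  = no λ ()
KT? KD-D = no λ ()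
KT? KT-D = yes refl

module Search {n : ℕ} {Var : Set} (_≟_ : DecidableEquality Var) where

  open import Data.List.Membership.DecPropositional _≟_ using (_∈?_)

  private
    Fm : Set
    Fm = Formula n Var

  depth : Fm → ℕ
  depth (var p)  = 0
  depth ⊥′       = 0
  depth (α ∧′ β) = depth α ⊔ depth β
  depth (α ∨′ β) = depth α ⊔ depth β
  depth (α →′ β) = depth α ⊔ depth β
  depth (¬′ α)   = depth α
  depth (D G α)  = suc (depth α)

  -- The part of a sequent that propositional rules cannot decompose; nothing
  -- stands for ⊥′ in the succedent.
  record State (d : ℕ) : Set where
    constructor state
    field
      {leftVars}   : List Var
      {leftBoxes}  : List (Grp n × Fm)
      {rightAtoms} : List (Maybe Var)
      {rightBoxes} : List (Grp n × Fm)
      left<d       : All (λ Gα → depth (proj₂ Gα) < d) leftBoxes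
      right<d      : All (λ Gα → depth (proj₂ Gα) < d) rightBoxes

    lhs rhs : List Fm
    lhs = map var leftVars ++ map (uncurry D) leftBoxes
    rhs = map (maybe′ var ⊥′) rightAtoms ++ map (uncurry D) rightBoxes

  open State using (lhs; rhs)

  -- In KT-D a stored box D G α on the left has already been unfolded by D-T, so
  -- α itself is still being decomposed and may be assumed true.
  record Refutes {d} (L : Logic) (t : Tree) (Γ Δ : List Fm) (S : State d) : Set where
    constructor refutes
    open State S
    field
      left-true        : All (L ∣ t ⊨_) Γ
      right-false      : All (L ∣ t ⊭_) Δ
      leftVars-true    : All (λ p → L ∣ t ⊨ var p) leftVars
      leftBoxes-true   : All (λ Gα → (L ≡ KT-D → L ∣ t ⊨ proj₂ Gα) →
                              L ∣ t ⊨ uncurry D Gα) leftBoxes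
      rightAtoms-false : All (λ q → L ∣ t ⊭ maybe′ var ⊥′ q) rightAtoms
      rightBoxes-false : All (λ Gα → L ∣ t ⊭ uncurry D Gα) rightBoxes

  -- `Γ` and `Δ` are still to be decomposed; `S` holds what has been set aside.
  Outcome : ∀ {d} → Logic → List Fm → List Fm → State d → Set
  Outcome L Γ Δ S =
    (L ⊢ᴳ Γ ++ lhs S ⇒ Δ ++ rhs S) ⊎ ∃ λ t → Refutes L t Γ Δ S

  module _ {L : Logic} {d : ℕ} {S : State d} where

    one-premise : ∀ {Γ Δ Γ′ Δ′} {S′ : State d} →
      (L ⊢ᴳ Γ ++ lhs S ⇒ Δ ++ rhs S → L ⊢ᴳ Γ′ ++ lhs S′ ⇒ Δ′ ++ rhs S′) →
      (∀ {t} → Refutes L t Γ Δ S → Refutes L t Γ′ Δ′ S′) →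
      Outcome L Γ Δ S → Outcome L Γ′ Δ′ S′
    one-premise rule f = Sum.map rule (Product.map₂ f)

    -- The last two functions express semantic invertibility: a tree refuting either premise already
    -- refutes the conclusion, so the search never backtracks over a propositional rule.
    two-premises : ∀ {Γ₁ Δ₁ Γ₂ Δ₂ Γ Δ} →
      (L ⊢ᴳ Γ₁ ++ lhs S ⇒ Δ₁ ++ rhs S → L ⊢ᴳ Γ₂ ++ lhs S ⇒ Δ₂ ++ rhs S →
       L ⊢ᴳ Γ ++ lhs S ⇒ Δ ++ rhs S) →
      (∀ {t} → Refutes L t Γ₁ Δ₁ S → Refutes L t Γ Δ S) →
      (∀ {t} → Refutes L t Γ₂ Δ₂ S → Refutes L t Γ Δ S) →
      Outcome L Γ₁ Δ₁ S → Outcome L Γ₂ Δ₂ S → Outcome L Γ Δ S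
    two-premises rule f g (inj₂ (t , r)) _              = inj₂ (t , f r)
    two-premises rule f g (inj₁ _)       (inj₂ (t , r)) = inj₂ (t , g r)
    two-premises rule f g (inj₁ d)       (inj₁ e)       = inj₁ (rule d e)

  -- Decomposition by the propositional rules and `D-T`

  mutual

    -- The continuation `k` handles the rest of the sequent and accepts any state, since decomposing
    -- α may enlarge the state. When a premise keeps both components, the decomposition of the
    -- second is the continuation of the first; recursion is thus structural in α.
    decomposeˡ : ∀ {L d Γ Δ} α → depth α ≤ d →
                 ((S : State d) → Outcome L Γ Δ S) →
                 (S : State d) → Outcome L (α ∷ Γ) Δ S
    decomposeˡ {Γ = Γ} (var p) _ k (state {leftVars = ps} l r) =
      one-premise (exch (shift (var p) Γ _) ↭-refl)
        (λ { (refutes γ δ (v ∷ vs) bs as cs) → refutes (v ∷ γ) δ vs bs as cs })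
        (k (state {leftVars = p ∷ ps} l r))
    decomposeˡ ⊥′ _ k S = inj₁ init⊥
    decomposeˡ (α ∧′ β) b k S =
      one-premise L∧
        (λ { (refutes (a ∷ b ∷ γ) δ vs bs as cs) → refutes (⊨∧⁺ a b ∷ γ) δ vs bs as cs })
        (decomposeˡ α (m⊔n≤o⇒m≤o _ _ b) (decomposeˡ β (m⊔n≤o⇒n≤o (depth α) _ b) k) S)
    decomposeˡ (α ∨′ β) b k S =
      two-premises L∨
        (λ { (refutes (a ∷ γ) δ vs bs as cs) → refutes (⊨∨⁺ˡ a ∷ γ) δ vs bs as cs })
        (λ { (refutes (b ∷ γ) δ vs bs as cs) → refutes (⊨∨⁺ʳ b ∷ γ) δ vs bs as cs })
        (decomposeˡ α (m⊔n≤o⇒m≤o _ _ b) k S)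
        (decomposeˡ β (m⊔n≤o⇒n≤o (depth α) _ b) k S)
    decomposeˡ (α →′ β) b k S =
      two-premises L→
        (λ { (refutes γ (a ∷ δ) vs bs as cs) → refutes (⊨→⁺ˡ a ∷ γ) δ vs bs as cs })
        (λ { (refutes (b ∷ γ) δ vs bs as cs) → refutes (⊨→⁺ʳ b ∷ γ) δ vs bs as cs })
        (decomposeʳ α (m⊔n≤o⇒m≤o _ _ b) k S)
        (decomposeˡ β (m⊔n≤o⇒n≤o (depth α) _ b) k S)
    decomposeˡ (¬′ α) b k S =
      one-premise L¬
        (λ { (refutes γ (a ∷ δ) vs bs as cs) → refutes (⊨¬⁺ a ∷ γ) δ vs bs as cs })
        (decomposeʳ α b k S)
    decomposeˡ {L} {Γ = Γ} (D G α) b k (state {leftVars = ps} l r) with KT? L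
    -- The box goes into the state and α is decomposed in its place. A refutation makes α true,
    -- which discharges the condition attached to the stored box.
    ... | yes refl =
      one-premise
        (D-T ∘ exch (↭-trans (prep α (↭-trans (++⁺ˡ Γ (shift (D G α) (map var ps) _))
                                              (shift (D G α) Γ _)))
                             (swap α (D G α) ↭-refl)) ↭-refl)
        (λ { (refutes (a ∷ γ) δ vs (b ∷ bs) as cs) →
          refutes (b (λ _ → a) ∷ γ) δ vs bs as cs })
        (decomposeˡ α (ℕ.<⇒≤ b) k (state (b ∷ l) r))
    ... | no L≢KT =
      one-premise
        (exch (↭-trans (++⁺ˡ Γ (shift (D G α) (map var ps) _)) (shift (D G α) Γ _))
              ↭-refl)
        (λ { (refutes γ δ vs (b ∷ bs) as cs) →
          refutes (b (λ eq → ⊥-elim (L≢KT eq)) ∷ γ) δ vs bs as cs })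
        (k (state (b ∷ l) r))

    decomposeʳ : ∀ {L d Γ Δ} α → depth α ≤ d →
                 ((S : State d) → Outcome L Γ Δ S) →
                 (S : State d) → Outcome L Γ (α ∷ Δ) S
    decomposeʳ {Δ = Δ} (var q) _ k (state {rightAtoms = qs} l r) =
      one-premise (exch ↭-refl (shift (var q) Δ _))
        (λ { (refutes γ δ vs bs (a ∷ as) cs) → refutes γ (a ∷ δ) vs bs as cs })
        (k (state {rightAtoms = just q ∷ qs} l r))
    decomposeʳ {Δ = Δ} ⊥′ _ k (state {rightAtoms = qs} l r) =
      one-premise (exch ↭-refl (shift ⊥′ Δ _))
        (λ { (refutes γ δ vs bs (a ∷ as) cs) → refutes γ (a ∷ δ) vs bs as cs })
        (k (state {rightAtoms = nothing ∷ qs} l r))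
    decomposeʳ (α ∧′ β) b k S =
      two-premises R∧
        (λ { (refutes γ (a ∷ δ) vs bs as cs) → refutes γ (⊭∧⁺ˡ a ∷ δ) vs bs as cs })
        (λ { (refutes γ (b ∷ δ) vs bs as cs) → refutes γ (⊭∧⁺ʳ b ∷ δ) vs bs as cs })
        (decomposeʳ α (m⊔n≤o⇒m≤o _ _ b) k S)
        (decomposeʳ β (m⊔n≤o⇒n≤o (depth α) _ b) k S)
    decomposeʳ (α ∨′ β) b k S =
      one-premise R∨
        (λ { (refutes γ (a ∷ b ∷ δ) vs bs as cs) → refutes γ (⊭∨⁺ a b ∷ δ) vs bs as cs })
        (decomposeʳ α (m⊔n≤o⇒m≤o _ _ b) (decomposeʳ β (m⊔n≤o⇒n≤o (depth α) _ b) k) S)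
    decomposeʳ (α →′ β) b k S =
      one-premise R→
        (λ { (refutes (a ∷ γ) (b ∷ δ) vs bs as cs) → refutes γ (⊭→⁺ a b ∷ δ) vs bs as cs })
        (decomposeˡ α (m⊔n≤o⇒m≤o _ _ b) (decomposeʳ β (m⊔n≤o⇒n≤o (depth α) _ b) k) S)
    decomposeʳ (¬′ α) b k S =
      one-premise R¬
        (λ { (refutes (a ∷ γ) δ vs bs as cs) → refutes γ (⊭¬⁺ a ∷ δ) vs bs as cs })
        (decomposeˡ α b k S)
    decomposeʳ {Δ = Δ} (D G α) b k (state {rightAtoms = qs} l r) =
      one-premise
        (exch ↭-refl (↭-trans (++⁺ˡ Δ (shift (D G α) (map (maybe′ var ⊥′) qs) _))
                              (shift (D G α) Δ _)))
        (λ { (refutes γ δ vs bs as (c ∷ cs)) → refutes γ (c ∷ δ) vs bs as cs })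
        (k (state l (b ∷ r)))

  decompose : ∀ {L d} Γ Δ → All (λ φ → depth φ ≤ d) Γ → All (λ φ → depth φ ≤ d) Δ →
              ((S : State d) → Outcome L [] [] S) →
              (S : State d) → Outcome L Γ Δ S
  decompose []      []      []       []       k = k
  decompose []      (α ∷ Δ) []       (b ∷ bs) k = decomposeʳ α b (decompose [] Δ [] bs k)
  decompose (α ∷ Γ) Δ       (b ∷ bs) cs       k = decomposeˡ α b (decompose Γ Δ bs cs k)

  Verdict : Logic → List Fm → List Fm → Set
  Verdict L Γ Δ = (L ⊢ᴳ Γ ⇒ Δ) ⊎ ∃ λ t → All (L ∣ t ⊨_) Γ × All (L ∣ t ⊭_) Δ

  -- Saturated sequents: modal rules and countermodels

  module Saturated {d : ℕ} (L : Logic) (S : State d)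
    (below : ∀ Γ Δ → All (λ φ → depth φ < d) Γ → All (λ φ → depth φ < d) Δ → Verdict L Γ Δ)
    where

    open State S hiding (lhs; rhs)

    within? : ∀ G → Decidable (λ (Hα : Grp n × Fm) → proj₁ Hα ⊆ G)
    within? G Hα = proj₁ Hα ⊆? G

    boxesWithin : Grp n → List (Grp n × Fm)
    boxesWithin G = filter (within? G) leftBoxes

    premise : Grp n → List Fm
    premise G = map proj₂ (boxesWithin G)

    -- A demand (G , βs) asks for a G-successor refuting βs: it is the premise of
    -- D-K when βs is a singleton, and of D-D when G is a singleton and βs empty.
    Demand : Set
    Demand = Grp n × List Fm

    boxedBySingleton? : Decidable (λ a → Any (λ Hα → proj₁ Hα ⊆ singleton a) leftBoxes)
    boxedBySingleton? a = Any.any? (within? (singleton a)) leftBoxes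

    -- Restricted to agents with a matching left box, because `D-D` requires a nonempty premise. For
    -- other agents seriality comes from a child or from the loop in `SelfLoop`.
    serialDemands : Logic → List Demand
    serialDemands KD-D = map (λ a → singleton a , []) (filter boxedBySingleton? (allFin n))
    serialDemands _    = []

    boxDemand : Grp n × Fm → Demand
    boxDemand (G , β) = G , [ β ]

    demands : List Demand
    demands = map boxDemand rightBoxes ++ serialDemands L

    data DemandView : Demand → Set where
      box    : ∀ {G β} → (G , β) ∈ rightBoxes → DemandView (G , [ β ])
      serial : ∀ {a} → L ≡ KD-D → Any (λ Hα → proj₁ Hα ⊆ singleton a) leftBoxes →
               DemandView (singleton a , [])

    -- The logic is a fixed parameter, so the case analysis runs on a copy `L′` tied to it by an
    -- equation.
    serialView : ∀ L′ {x} → L ≡ L′ → x ∈ serialDemands L′ → DemandView x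
    serialView KD-D eq i with ∈-map⁻ (λ a → singleton a , []) i
    ... | a , j , refl =
      serial eq (proj₂ (∈-filter⁻ boxedBySingleton? {xs = allFin n} j))

    demandView : ∀ {x} → x ∈ demands → DemandView x
    demandView i with ∈-++⁻ (map boxDemand rightBoxes) i
    ... | inj₂ j = serialView L refl j
    ... | inj₁ j with ∈-map⁻ boxDemand j
    ...   | _ , k , refl = box k

    demand<d : ∀ {x} → DemandView x → All (λ φ → depth φ < d) (proj₂ x)
    demand<d (box i)      = All.lookup right<d i ∷ []
    demand<d (serial _ _) = []

    -- The context Σ of `D-K` and `D-D`.
    outside : Grp n → List Fm
    outside G = map var leftVars ++ map (uncurry D) (filter (¬? ∘ within? G) leftBoxes)

    lhs-split : ∀ G → outside G ++ map (uncurry D) (boxesWithin G) ↭ lhs S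
    lhs-split G
      rewrite ++-assoc (map var leftVars)
                (map (uncurry D) (filter (¬? ∘ within? G) leftBoxes))
                (map (uncurry D) (boxesWithin G))
            | sym (map-++ (uncurry D) (filter (¬? ∘ within? G) leftBoxes) (boxesWithin G))
      = ++⁺ˡ (map var leftVars) (map⁺ (uncurry D) (filter-↭ (within? G) leftBoxes))

    outside-side : ∀ {P : Grp n → Set} G → (∀ {H} → H ⊈ G → P H) → All (Side P) (outside G)
    outside-side G f = Allₚ.++⁺
      (Allₚ.map⁺ (All.universal var leftVars))
      (Allₚ.map⁺ (All.map (λ {Hα} H⊈G → box (proj₂ Hα) (f {proj₁ Hα} H⊈G))
                          (Allₚ.all-filter (¬? ∘ within? G) leftBoxes)))

    rhs-side : All (Side (λ _ → ⊤)) (rhs S)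
    rhs-side = Allₚ.++⁺
      (Allₚ.map⁺ (All.universal (λ { (just q) → var q ; nothing → bot }) rightAtoms))
      (Allₚ.map⁺ (All.universal (λ Gα → box (proj₂ Gα) tt) rightBoxes))

    -- A nonempty group within a singleton equals it, so these boxes have the form that `D-D`
    -- prescribes.
    boxesWithin-singleton : ∀ {a} xs → All (λ Hα → proj₁ Hα ⊆ singleton a) xs →
      map (D (singleton a)) (map proj₂ xs) ≡ map (uncurry (D {n} {Var})) xs
    boxesWithin-singleton [] [] = refl
    boxesWithin-singleton ((G , α) ∷ xs) (i ∷ is) =
      cong₂ _∷_ (cong (λ H → D H α) (sym (⊆-singleton⇒≡ {G = G} i)))
                (boxesWithin-singleton xs is)

    demand-rule : ∀ {x} → DemandView x → L ⊢ᴳ premise (proj₁ x) ⇒ proj₂ x → L ⊢ᴳ lhs S ⇒ rhs S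
    demand-rule (box {G} {β} i) e
      with ∈⇒↭ (∈-++⁺ʳ (map (maybe′ var ⊥′) rightAtoms) (∈-map⁺ (uncurry D) i))
    ... | Ω , p =
      exch (lhs-split G) p
        (D-K (boxesWithin G) (Allₚ.all-filter (within? G) leftBoxes)
          (outside-side G λ H⊈G → H⊈G)
          (All.tail (All-resp-↭ (↭-sym p) rhs-side)) e)
    demand-rule (serial {a} refl some) e =
      exch (lhs-split (singleton a)) ↭-refl
        (subst (λ Γ → KD-D ⊢ᴳ outside (singleton a) ++ Γ ⇒ rhs S)
          (boxesWithin-singleton (boxesWithin (singleton a))
            (Allₚ.all-filter (within? (singleton a)) leftBoxes))
          (D-D a premise≢[]
            (outside-side (singleton a) λ { H⊈a refl → H⊈a λ i → i }) rhs-side e))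
      where
      premise≢[] : premise (singleton a) ≢ []
      premise≢[] eq with find some
      ... | Hα , i , H⊆a
        with subst (proj₂ Hα ∈_) eq (∈-map⁺ proj₂ (∈-filter⁺ (within? (singleton a)) i H⊆a))
      ... | ()

    -- A child on an edge labelled `K` is a successor for every group within `K`, so all left boxes
    -- of such groups constrain it.
    Safe : Grp n × Tree → Set
    Safe (K , u) = ∀ {H α} → (H , α) ∈ leftBoxes → H ⊆ K → L ∣ u ⊨ α

    Meets : Demand → Grp n × Tree → Set
    Meets (G , βs) (K , u) = K ≡ G × All (L ∣ u ⊭_) βs

    Successors : List Demand → Set
    Successors xs = ∃ λ ts → All Safe ts × All (λ x → Any (Meets x) ts) xs

    -- Every demand is searched at lower modal depth. One derivable premise derives the whole
    -- sequent; if all are refuted, the refuting trees become the children of the countermodel.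
    collect : ∀ xs → (∀ {x} → x ∈ xs → DemandView x) →
              (L ⊢ᴳ lhs S ⇒ rhs S) ⊎ Successors xs
    collect [] _ = inj₂ ([] , [] , [])
    collect ((G , βs) ∷ xs) view
      with below (premise G) βs
             (Allₚ.map⁺ (Allₚ.filter⁺ (within? G) left<d)) (demand<d (view (here refl)))
         | collect xs (view ∘ there)
    ... | inj₁ e | _ = inj₁ (demand-rule (view (here refl)) e)
    ... | inj₂ _ | inj₁ e = inj₁ e
    ... | inj₂ (u , p , q) | inj₂ (ts , safe , met) =
      inj₂ ( (G , u) ∷ ts
           , (λ i H⊆G → All.lookup p (∈-map⁺ proj₂ (∈-filter⁺ (within? G) i H⊆G))) ∷ safe
           , here (refl , q) ∷ All.map there met)

    module Countermodel
      (disjoint : All (λ q → ∀ {p} → q ≡ just p → ¬ (p ∈ leftVars)) rightAtoms)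
      (ts : List (Grp n × Tree)) (safe : All Safe ts)
      (met : All (λ x → Any (Meets x) ts) demands)
      where

      root : Tree
      root = node (λ p → does (p ∈? leftVars)) ts

      -- In KD-D a loop for `G` needs `G` within some `singleton a` and within no child label. But
      -- the left box of `G` raises a serial demand for `a`, met by a child labelled `singleton a`.
      loop-free : ∀ L′ {G α} → L ≡ L′ → (G , α) ∈ leftBoxes →
                  SelfLoop L′ G root → L′ ≡ KT-D
      loop-free KT-D _ _ _ = refl
      loop-free KD-D {G} refl i ((a , G⊆a) , none) =
        ⊥-elim (absurd (find (All.lookup met demanded)))
        where
        demanded : (singleton a , []) ∈ demands
        demanded = ∈-++⁺ʳ (map boxDemand rightBoxes)
          (∈-map⁺ (λ a → singleton a , [])
            (∈-filter⁺ boxedBySingleton? (∈-allFin a) (lose i G⊆a)))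
        absurd : (∃ λ c → c ∈ ts × Meets (singleton a , []) c) → ⊥
        absurd (c , j , refl , _) = All.lookup none j G⊆a

      leftBox-true : ∀ {Gα} → Gα ∈ leftBoxes → (L ≡ KT-D → L ∣ root ⊨ proj₂ Gα) →
                     L ∣ root ⊨ uncurry D Gα
      leftBox-true {G , α} i now = ⊨D⁺ λ
        { (inj₁ (loop , refl))    → now (loop-free L refl i loop)
        ; (inj₂ (K , G⊆K , j)) → All.lookup safe j i G⊆K }

      rightBox-false : ∀ {Gα} → Gα ∈ rightBoxes → L ∣ root ⊭ uncurry D Gα
      rightBox-false i
        with find (All.lookup met (∈-++⁺ˡ (∈-map⁺ boxDemand i)))
      ... | (K , u) , j , refl , q ∷ [] = ⊭D⁺ (inj₂ (K , (λ k → k) , j)) q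

      leftVar-true : ∀ {p} → p ∈ leftVars → L ∣ root ⊨ var p
      leftVar-true {p} i = ⊨-intro (dec-true (p ∈? leftVars) i)

      rightAtom-false : ∀ {q} → (∀ {p} → q ≡ just p → ¬ (p ∈ leftVars)) →
                        L ∣ root ⊭ maybe′ var ⊥′ q
      rightAtom-false {just p}  h = ⊭-intro (dec-false (p ∈? leftVars) (h refl))
      rightAtom-false {nothing} h = ⊭-intro refl

      root-refutes : Refutes L root [] [] S
      root-refutes = refutes [] [] (All.tabulate leftVar-true) (All.tabulate leftBox-true)
        (All.map rightAtom-false disjoint) (All.tabulate rightBox-false)

    initial? : ∀ q → (∀ {p} → q ≡ just p → ¬ (p ∈ leftVars)) ⊎
                     (∃ λ p → q ≡ just p × p ∈ leftVars)
    initial? nothing = inj₁ λ ()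
    initial? (just p) with p ∈? leftVars
    ... | yes i = inj₂ (p , refl , i)
    ... | no ¬i = inj₁ λ { refl → ¬i }

    outcome : Outcome L [] [] S
    outcome with All.decide initial? rightAtoms
    ... | inj₂ some with find some
    ...   | _ , i , p , refl , j
            with ∈⇒↭ (∈-++⁺ˡ {ys = map (uncurry D) leftBoxes} (∈-map⁺ var j))
               | ∈⇒↭ (∈-++⁺ˡ {ys = map (uncurry D) rightBoxes} (∈-map⁺ (maybe′ var ⊥′) i))
    ...     | _ , l | _ , r = inj₁ (exch l r (init p))
    outcome | inj₁ disjoint with collect demands demandView
    ... | inj₁ e = inj₁ e
    ... | inj₂ (ts , safe , met) =
      inj₂ (_ , Countermodel.root-refutes disjoint ts safe met)

  -- Recursion on modal depth and completeness

  search : ∀ L d Γ Δ → All (λ φ → depth φ ≤ d) Γ → All (λ φ → depth φ ≤ d) Δ → Verdict L Γ Δ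
  search L d Γ Δ bs cs
    with decompose {d = d} Γ Δ bs cs (λ S → Saturated.outcome L S (below d)) (state [] [])
    where
    below : ∀ d Γ Δ → All (λ φ → depth φ < d) Γ → All (λ φ → depth φ < d) Δ → Verdict L Γ Δ
    -- No formula has depth below 0, so the sequent is empty and any tree refutes it; a leaf is
    -- chosen.
    below zero    []      []      _        _        = inj₂ (node (λ _ → false) [] , [] , [])
    below zero    []      (_ ∷ _) _        (() ∷ _)
    below zero    (_ ∷ _) _       (() ∷ _) _
    below (suc d) Γ       Δ       bs       cs       =
      search L d Γ Δ (All.map s≤s⁻¹ bs) (All.map s≤s⁻¹ cs)
  ... | inj₁ e = inj₁ (subst₂ (L ⊢ᴳ_⇒_) (++-identityʳ Γ) (++-identityʳ Δ) e)
  ... | inj₂ (t , r) = inj₂ (t , Refutes.left-true r , Refutes.right-false r)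

  hilbert⇒sequent : ∀ {L A} → L ⊢ᴴ A → L ⊢ᴳ [] ⇒ [ A ]
  hilbert⇒sequent {L} {A} h with search L (depth A) [] [ A ] [] (≤-refl ∷ [])
  ... | inj₁ e                    = e
  ... | inj₂ (t , [] , A-false ∷ []) = ⊥-elim (⊨-⊭ (hilbert-sound h t) A-false)

theorem3p14 : (m : ℕ) (Var : Set) → Var ↣ ℕ →
    (L : Logic) (A : Formula (suc m) Var) → (L ⊢ᴴ A) ⇔ (L ⊢ᴳ [] ⇒ [ A ])
theorem3p14 m Var inj L A =
  -- The injection into ℕ makes equality of variables decidable, as needed to detect initial
  -- sequents and to define the valuation at the root.
  mk⇔ (Search.hilbert⇒sequent (via-injection inj ℕ._≟_)) sequent⇒hilbert
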